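{- Let $X$ be a finite set with $|X|\ge 2$. The free monoid $\mathbb{M}_X$ with basis $X$ is atomic and, therefore, homogeneous.
   Context: For a structure $\mathbb{B}$ and a tuple $\bar b$ of elements of $\mathbb{B}$, the type of $\bar b$ is the set of all formulas $\phi(\bar x)$ (without parameters) in the language of $\mathbb{B}$ with $\mathbb{B}\models\phi(\bar b)$. A complete $n$-type $p$ of $Th(\mathbb{B})$ is isolated if there is a formula $\phi(\bar x)\in p$ such that for all formulas $\psi(\bar x)$, $\psi(\bar x)\in p$ if and only if $Th(\mathbb{B})\models(\phi(\bar x)\Rightarrow\psi(\bar x))$. $\mathbb{B}$ is atomic if every complete type (over $\emptyset$) that is realized in $\mathbb{B}$ is isolated. $\mathbb{B}$ is homogeneous if two finite tuples of elements of $\mathbb{B}$ realize the same type if and only if some automorphism of $\mathbb{B}$ maps one to the other. -}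

module Defs where

open import Data.Empty using (⊥)
open import Data.Fin.Base using (Fin)
open import Data.List.Base using (List; []; _++_)
open import Data.Nat.Base using (ℕ; suc)
open import Data.Product.Base using (Σ-syntax; ∃-syntax; _×_)
open import Data.Vec.Base using (Vec; []; _∷_; lookup; map)
open import Function.Base using (id)
open import Function.Bundles using (_⇔_; _↔_; module Inverse)
open import Level using (0ℓ)
open import Relation.Binary.PropositionalEquality.Core using (_≡_)
open import Relation.Nullary.Negation.Core using (¬_)
open import Relation.Unary using (Pred; _∈_; _∉_; _⊆_)

record Language : Set₁ where
  field
    Fun : ℕ → Set
    Rel : ℕ → Set

record Structure (L : Language) : Set₁ where
  open Language L
  field
    Carrier : Set
    fun     : ∀ {k} → Fun k → Vec Carrier k → Carrier
    rel     : ∀ {k} → Rel k → Vec Carrier k → Set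

open Structure using (Carrier)

module _ (L : Language) where
  open Language L

  data Term (n : ℕ) : Set where
    var : Fin n → Term n
    app : ∀ {k} → Fun k → Vec (Term n) k → Term n

  infix  7 _≐_
  infixr 6 _⇒_

  -- Formulas with free variables among x₀, …, xₙ₋₁ (de Bruijn indices;
  -- `all` binds index zero).  Over classical logic ⊥, ⇒ and ∀ define the
  -- remaining connectives and quantifiers.
  data Formula (n : ℕ) : Set where
    _≐_ : Term n → Term n → Formula n
    rel : ∀ {k} → Rel k → Vec (Term n) k → Formula n
    bot : Formula n
    _⇒_ : Formula n → Formula n → Formula n
    all : Formula (suc n) → Formula n

  Sentence : Set
  Sentence = Formula 0

  Theory : Set₁
  Theory = Pred Sentence 0ℓ

module _ {L : Language} where

  infix 8 ~_

  ~_ : ∀ {n} → Formula L n → Formula L n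
  ~ φ = φ ⇒ bot

  module _ (B : Structure L) where
    private module B = Structure B

    eval    : ∀ {n} → Term L n → Vec B.Carrier n → B.Carrier
    evalAll : ∀ {n k} → Vec (Term L n) k → Vec B.Carrier n → Vec B.Carrier k

    eval (var i)    v = lookup v i
    eval (app f ts) v = B.fun f (evalAll ts v)

    evalAll []       v = []
    evalAll (t ∷ ts) v = eval t v ∷ evalAll ts v

  infix 4 _⊨_[_]

  -- Atomic formulas are doubly negated, so that satisfaction obeys
  -- classical logic (see ⊨-stable) without any classical axiom.
  _⊨_[_] : ∀ {n} (B : Structure L) → Formula L n → Vec (Carrier B) n → Set
  B ⊨ s ≐ t    [ v ] = ¬ ¬ (eval B s v ≡ eval B t v)
  B ⊨ rel R ts [ v ] = ¬ ¬ Structure.rel B R (evalAll B ts v)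
  B ⊨ bot      [ v ] = ⊥
  B ⊨ φ ⇒ ψ    [ v ] = B ⊨ φ [ v ] → B ⊨ ψ [ v ]
  B ⊨ all φ    [ v ] = ∀ b → B ⊨ φ [ b ∷ v ]

  ⊨-stable : ∀ {n} (B : Structure L) (φ : Formula L n) (v : Vec (Carrier B) n) →
             ¬ ¬ (B ⊨ φ [ v ]) → B ⊨ φ [ v ]
  ⊨-stable B (s ≐ t)    v h = λ k → h (λ p → p k)
  ⊨-stable B (rel R ts) v h = λ k → h (λ p → p k)
  ⊨-stable B bot        v h = h id
  ⊨-stable B (φ ⇒ ψ)    v h = λ p → ⊨-stable B ψ v (λ k → h (λ q → k (q p)))
  ⊨-stable B (all φ)    v h = λ b → ⊨-stable B φ (b ∷ v) (λ k → h (λ q → k (q b)))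

  Th : Structure L → Theory L
  Th B σ = B ⊨ σ [ [] ]

  _IsModelOf_ : Structure L → Theory L → Set
  N IsModelOf T = T ⊆ Th N

  infix 4 _⊩_

  -- Semantic consequence; the free variables of φ are read universally.
  _⊩_ : ∀ {n} → Theory L → Formula L n → Set₁
  T ⊩ φ = ∀ N → N IsModelOf T → ∀ v → N ⊨ φ [ v ]

  tp : ∀ {n} (B : Structure L) → Vec (Carrier B) n → Pred (Formula L n) 0ℓ
  tp B b φ = B ⊨ φ [ b ]

  Realizes : ∀ {n} (B : Structure L) → Vec (Carrier B) n → Pred (Formula L n) 0ℓ → Set
  Realizes B b p = p ⊆ tp B b

  -- Both fields are phrased negatively.  Classically they say that p is
  -- realized in some model of T, and that φ ∈ p or ~ φ ∈ p for every φ.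
  -- With a constructive disjunction instead, only decidable sets of
  -- formulas would qualify, which in general excludes tp B b.
  record IsCompleteType {n} (T : Theory L) (p : Pred (Formula L n) 0ℓ) : Set₁ where
    field
      satisfiable : ¬ (∀ N → N IsModelOf T → ∀ b → ¬ Realizes N b p)
      complete    : ∀ φ → (~ φ) ∉ p → φ ∈ p

  IsIsolated : ∀ {n} → Theory L → Pred (Formula L n) 0ℓ → Set₁
  IsIsolated T p = ∃[ φ ] φ ∈ p × (∀ ψ → ψ ∈ p ⇔ T ⊩ φ ⇒ ψ)

  Atomic : Structure L → Set₁
  Atomic B = ∀ {n} (p : Pred (Formula L n) 0ℓ) → IsCompleteType (Th B) p →
             ∃[ b ] Realizes B b p → IsIsolated (Th B) p

  record Automorphism (B : Structure L) : Set where
    private module B = Structure B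
    field
      bijection : B.Carrier ↔ B.Carrier
    open Inverse bijection public using (to; from)
    field
      fun-homo : ∀ {k} (f : Language.Fun L k) v → to (B.fun f v) ≡ B.fun f (map to v)
      rel-homo : ∀ {k} (R : Language.Rel L k) v → B.rel R v ⇔ B.rel R (map to v)

  SameType : ∀ {n} (B : Structure L) → Vec (Carrier B) n → Vec (Carrier B) n → Set
  SameType B a b = ∀ φ → φ ∈ tp B a ⇔ φ ∈ tp B b

  Homogeneous : Structure L → Set
  Homogeneous B = ∀ {n} (a b : Vec (Carrier B) n) →
    SameType B a b ⇔ (Σ[ α ∈ Automorphism B ] map (Automorphism.to α) a ≡ b)

data MonoidFun : ℕ → Set where
  unit : MonoidFun 0
  mult : MonoidFun 2

monoidLanguage : Language
monoidLanguage = record { Fun = MonoidFun ; Rel = λ _ → ⊥ }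

freeMonoid : Set → Structure monoidLanguage
freeMonoid X = record { Carrier = List X ; fun = op ; rel = λ () }
  where
  op : ∀ {k} → MonoidFun k → Vec (List X) k → List X
  op unit []           = []
  op mult (u ∷ v ∷ []) = u ++ v

{-# OPTIONS --safe #-}

-- The letters are exactly the irreducible non-units of the free monoid, so
-- the k-tuples that enumerate X are first-order definable, and each of them is
-- carried to each other one by the automorphism permuting the letters.  Hence
-- "some enumeration y of the letters expresses x as the words a" defines the
-- automorphism orbit of a.  Since automorphisms preserve types, this formula
-- isolates the type of a, and a tuple of the same type lies in its orbit.

module Submission where

open import Data.Empty using (⊥-elim)
open import Data.Fin.Base using (Fin; zero; suc; _↑ˡ_; _↑ʳ_; punchOut)
open import Data.Fin.Properties
  using (_≟_; any?; all?; injective⇒≤; inj⇒≟; punchOut-injective)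
open import Data.List.Base as List using (List; []; _∷_; [_])
open import Data.List.Properties
  using (map-++; map-∘; map-id; map-cong; ++-conicalʳ; ∷-injectiveˡ; ∷-injectiveʳ)
  renaming (≡-dec to list-≡-dec)
open import Data.Nat.Base using (ℕ; zero; suc; _≤_; _+_)
open import Data.Nat.Properties using (1+n≰n)
open import Data.Product.Base using (Σ-syntax; ∃; ∃-syntax; _×_; _,_; proj₁; proj₂)
open import Data.Vec.Base using (Vec; []; _∷_; _++_; lookup; map; tabulate)
open import Data.Vec.Properties
  using (lookup-map; lookup-++ˡ; lookup-++ʳ; lookup∘tabulate; tabulate∘lookup; tabulate-cong)
  renaming (≡-dec to vec-≡-dec)
open import Function.Base using (_∘_; id)
open import Function.Bundles
  using (_⇔_; _↔_; mk⇔; mk↔ₛ′; module Equivalence; module Injection; module Inverse)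
open import Function.Definitions using (Injective)
open import Function.Properties.Inverse using (↔-trans; Inverse⇒Injection)
open import Relation.Binary.Definitions using (DecidableEquality)
open import Relation.Binary.PropositionalEquality
  using (_≡_; _≢_; refl; sym; trans; cong; cong₂; subst; module ≡-Reasoning)
open import Relation.Nullary.Decidable using (Dec; yes; no; map′; decidable-stable; _×-dec_)
open import Relation.Nullary.Negation.Core using (¬_; contradiction)
open import Relation.Unary using (Decidable; Pred)
open import Level using (0ℓ)
open import Defs

open Equivalence using (to; from)

-- Finite search and bijections of finite sets.

any-vec? : ∀ {A : Set} → (∀ {Q : Pred A 0ℓ} → Decidable Q → Dec (∃ Q)) →
           ∀ m {P : Pred (Vec A m) 0ℓ} → Decidable P → Dec (∃ P)
any-vec? anyA? zero    P? = map′ (λ p → [] , p) (λ { ([] , p) → p }) (P? [])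
any-vec? anyA? (suc m) P? =
  map′ (λ { (x , xs , p) → x ∷ xs , p }) (λ { (x ∷ xs , p) → x , xs , p })
       (anyA? λ x → any-vec? anyA? m λ xs → P? (x ∷ xs))

-- Pigeonhole: if `f` misses `j`, then `punchOut` at `j` turns `f` into an injection into a set with
-- one element fewer.
injective⇒surjective : ∀ {n} {f : Fin n → Fin n} → Injective _≡_ _≡_ f →
                       ∀ j → ∃[ i ] f i ≡ j
injective⇒surjective {suc n} {f} f-inj j with any? (λ i → f i ≟ j)
... | yes hit = hit
... | no miss = contradiction
  (injective⇒≤ {f = λ i → punchOut (j≢f i)} λ {x} {y} → f-inj ∘ punchOut-injective (j≢f x) (j≢f y))
  1+n≰n
  where
  j≢f : ∀ i → j ≢ f i
  j≢f i j≡fi = miss (i , sym j≡fi)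

-- A section `g` of `s` is injective. Transported along `A ↔ Fin k` it becomes an injective self-map
-- of `Fin k`, hence surjective, so `g` is a two-sided inverse of `s`.
surjective⇒↔ : ∀ {A : Set} {k} → A ↔ Fin k → (s : Fin k → A) →
               (∀ x → ∃[ i ] s i ≡ x) → Fin k ↔ A
surjective⇒↔ {A} {k} A↔Fin s surj = mk↔ₛ′ s g s∘g g∘s
  where
  module A↔Fin = Inverse A↔Fin

  g : A → Fin k
  g = proj₁ ∘ surj

  s∘g : ∀ x → s (g x) ≡ x
  s∘g = proj₂ ∘ surj

  g∘from-injective : Injective _≡_ _≡_ (g ∘ A↔Fin.from)
  g∘from-injective {i} {j} eq = begin
    i                                       ≡⟨ A↔Fin.strictlyInverseˡ i ⟨
    A↔Fin.to (A↔Fin.from i)                 ≡⟨ cong A↔Fin.to (s∘g (A↔Fin.from i)) ⟨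
    A↔Fin.to (s (g (A↔Fin.from i)))         ≡⟨ cong (A↔Fin.to ∘ s) eq ⟩
    A↔Fin.to (s (g (A↔Fin.from j)))         ≡⟨ cong A↔Fin.to (s∘g (A↔Fin.from j)) ⟩
    A↔Fin.to (A↔Fin.from j)                 ≡⟨ A↔Fin.strictlyInverseˡ j ⟩
    j                                       ∎
    where open ≡-Reasoning

  g∘s : ∀ i → g (s i) ≡ i
  g∘s i with j , refl ← injective⇒surjective g∘from-injective i = cong g (s∘g (A↔Fin.from j))

lookup-ext : ∀ {A : Set} {n} {u v : Vec A n} → (∀ i → lookup u i ≡ lookup v i) → u ≡ v
lookup-ext {u = u} {v} eq =
  trans (sym (tabulate∘lookup u)) (trans (tabulate-cong eq) (tabulate∘lookup v))

-- Satisfaction, automorphisms and definable orbits.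

module _ {L : Language} where

  infixr 6 _⇛_

  -- Iterated implication carries a finite conjunction of premises in curried form, so that no
  -- conjunction is encoded through negations.
  _⇛_ : ∀ {m n} → (Fin m → Formula L n) → Formula L n → Formula L n
  _⇛_ {zero}  Γ ψ = ψ
  _⇛_ {suc m} Γ ψ = Γ zero ⇒ (Γ ∘ suc) ⇛ ψ

  alls : ∀ k {n} → Formula L (k + n) → Formula L n
  alls zero    φ = φ
  alls (suc k) φ = alls k (all φ)

  closure : ∀ {n} → Formula L n → Sentence L
  closure {zero}  φ = φ
  closure {suc n} φ = closure (all φ)

  module _ (B : Structure L) where
    private module B = Structure B

    ⊨-⇛ : ∀ {m n} (Γ : Fin m → Formula L n) {ψ : Formula L n} {v : Vec B.Carrier n} →
          B ⊨ Γ ⇛ ψ [ v ] ⇔ ((∀ i → B ⊨ Γ i [ v ]) → B ⊨ ψ [ v ])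
    ⊨-⇛ {zero}  Γ = mk⇔ (λ p _ → p) (λ h → h λ ())
    ⊨-⇛ {suc m} Γ = mk⇔
      (λ p ps → to (⊨-⇛ (Γ ∘ suc)) (p (ps zero)) (ps ∘ suc))
      (λ h p → from (⊨-⇛ (Γ ∘ suc)) λ ps → h λ { zero → p ; (suc i) → ps i })

    ⊨-alls : ∀ k {n} {φ : Formula L (k + n)} {v : Vec B.Carrier n} →
             B ⊨ alls k φ [ v ] ⇔ (∀ w → B ⊨ φ [ w ++ v ])
    ⊨-alls zero    = mk⇔ (λ { p [] → p }) (λ h → h [])
    ⊨-alls (suc k) = mk⇔
      (λ { p (b ∷ w) → to (⊨-alls k) p w b })
      (λ h → from (⊨-alls k) λ w b → h (b ∷ w))

    ⊨-closure : ∀ {n} (φ : Formula L n) → B ⊨ closure φ [ [] ] ⇔ (∀ v → B ⊨ φ [ v ])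
    ⊨-closure {zero}  φ = mk⇔ (λ { p [] → p }) (λ h → h [])
    ⊨-closure {suc n} φ = mk⇔
      (λ { p (b ∷ v) → to (⊨-closure (all φ)) p v b })
      (λ h → from (⊨-closure (all φ)) λ v b → h (b ∷ v))

  -- `B` is a model of its own theory. Conversely, if `φ` holds throughout `B`, its universal
  -- closure belongs to `Th B` and so passes to every model.
  Th-⊩ : ∀ {n} (B : Structure L) (φ : Formula L n) → Th B ⊩ φ ⇔ (∀ v → B ⊨ φ [ v ])
  Th-⊩ B φ = mk⇔ (λ h → h B λ {_} p → p)
    λ h N N⊨Th → to (⊨-closure N φ) (N⊨Th {closure φ} (from (⊨-closure B φ) h))

  module _ {B : Structure L} (α : Automorphism B) where
    private
      module B = Structure B
      module α = Automorphism α
      module α↔ = Inverse α.bijection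

    eval-automorphism : ∀ {n} (t : Term L n) v → eval B t (map α.to v) ≡ α.to (eval B t v)
    evalAll-automorphism : ∀ {n k} (ts : Vec (Term L n) k) v →
                           evalAll B ts (map α.to v) ≡ map α.to (evalAll B ts v)

    eval-automorphism (var i)    v = lookup-map i α.to v
    eval-automorphism (app f ts) v =
      trans (cong (B.fun f) (evalAll-automorphism ts v)) (sym (α.fun-homo f (evalAll B ts v)))

    evalAll-automorphism []       v = refl
    evalAll-automorphism (t ∷ ts) v = cong₂ _∷_ (eval-automorphism t v) (evalAll-automorphism ts v)

    -- By induction on the formula: equations are reflected because the automorphism is injective,
    -- and quantifiers are preserved because it is surjective.
    ⊨-automorphism : ∀ {n} (φ : Formula L n) v → B ⊨ φ [ v ] ⇔ B ⊨ φ [ map α.to v ]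
    ⊨-automorphism (s ≐ t) v
      rewrite eval-automorphism s v | eval-automorphism t v =
      mk⇔ (λ p k → p (k ∘ cong α.to))
          (λ p k → p (k ∘ Injection.injective (Inverse⇒Injection α.bijection)))
    ⊨-automorphism (rel R ts) v
      rewrite evalAll-automorphism ts v =
      mk⇔ (λ p k → p (k ∘ to R⇔)) (λ p k → p (k ∘ from R⇔))
      where R⇔ = α.rel-homo R (evalAll B ts v)
    ⊨-automorphism bot     v = mk⇔ id id
    ⊨-automorphism (φ ⇒ ψ) v = mk⇔
      (λ h p → to (⊨-automorphism ψ v) (h (from (⊨-automorphism φ v) p)))
      (λ h p → from (⊨-automorphism ψ v) (h (to (⊨-automorphism φ v) p)))
    ⊨-automorphism (all φ) v = mk⇔
      (λ h b → subst (λ c → B ⊨ φ [ c ∷ map α.to v ]) (α↔.strictlyInverseˡ b)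
                 (to (⊨-automorphism φ (α.from b ∷ v)) (h (α.from b))))
      (λ h b → from (⊨-automorphism φ (b ∷ v)) (h (α.to b)))

  module _ (B : Structure L)
    (φ     : ∀ {n} → Vec (Structure.Carrier B) n → Formula L n)
    (⊨φ    : ∀ {n} (a : Vec (Structure.Carrier B) n) → B ⊨ φ a [ a ])
    (orbit : ∀ {n} (a b : Vec (Structure.Carrier B) n) → B ⊨ φ a [ b ] →
             Σ[ α ∈ Automorphism B ] map (Automorphism.to α) a ≡ b)
    where

    -- Every tuple satisfying `φ a` lies in the orbit of `a`, so it satisfies all that `a`
    -- satisfies; hence `φ a` isolates the type.
    orbits-definable⇒atomic : Atomic B
    orbits-definable⇒atomic p p-complete (a , realizes) =
      φ a , tp⊆p (φ a) (⊨φ a) , λ ψ → mk⇔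
        (λ ψ∈p → from (Th-⊩ B (φ a ⇒ ψ)) λ b φb → transfer ψ b (orbit a b φb) (realizes ψ∈p))
        (λ φ⇒ψ → tp⊆p ψ (to (Th-⊩ B (φ a ⇒ ψ)) φ⇒ψ a (⊨φ a)))
      where
      -- Completeness makes `p` maximal: were `~ ψ` in `p`, the realization `a` would refute `ψ`.
      tp⊆p : ∀ ψ → B ⊨ ψ [ a ] → p ψ
      tp⊆p ψ ψa = IsCompleteType.complete p-complete ψ λ ¬ψ∈p → realizes ¬ψ∈p ψa

      transfer : ∀ ψ b → Σ[ α ∈ Automorphism B ] map (Automorphism.to α) a ≡ b →
                 B ⊨ ψ [ a ] → B ⊨ ψ [ b ]
      transfer ψ _ (α , refl) = to (⊨-automorphism α ψ a)

    orbits-definable⇒homogeneous : Homogeneous B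
    orbits-definable⇒homogeneous a b = mk⇔
      (λ same → orbit a b (to (same (φ a)) (⊨φ a)))
      (λ { (α , refl) ψ → ⊨-automorphism α ψ a })

-- Letters as the irreducible non-units.

infix 8 _·_

1ᵗ : ∀ {n} → Term monoidLanguage n
1ᵗ = app unit []

_·_ : ∀ {n} → Term monoidLanguage n → Term monoidLanguage n → Term monoidLanguage n
s · t = app mult (s ∷ t ∷ [])

wordTerm : ∀ {X : Set} {n} → (X → Term monoidLanguage n) → List X → Term monoidLanguage n
wordTerm t = List.foldr (λ x → t x ·_) 1ᵗ

-- Index one is the left factor and index zero the right one; "one of them is the unit" is written
-- as an implication.
nonUnit irreducible : ∀ {n} → Fin n → Formula monoidLanguage n
nonUnit     i = ~ (var i ≐ 1ᵗ)
irreducible i = all (all (var (suc zero) · var zero ≐ var (suc (suc i)) ⇒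
                          ~ (var (suc zero) ≐ 1ᵗ) ⇒ var zero ≐ 1ᵗ))

module _ {X : Set} where
  private
    M : Structure monoidLanguage
    M = freeMonoid X

  -- The map `s` is the identity when a tuple is tested against its own formula, and an unknown
  -- relabelling of the letters when the formula is decoded.
  eval-wordTerm : ∀ {n} {t : X → Term monoidLanguage n} {s : X → X} {v : Vec (List X) n} →
                  (∀ x → eval M (t x) v ≡ [ s x ]) →
                  ∀ w → eval M (wordTerm t w) v ≡ List.map s w
  eval-wordTerm t≡s []      = refl
  eval-wordTerm t≡s (x ∷ w) = cong₂ List._++_ (t≡s x) (eval-wordTerm t≡s w)

  letter-nonUnit : ∀ {n x} (i : Fin n) v → lookup v i ≡ [ x ] → M ⊨ nonUnit i [ v ]
  letter-nonUnit i v vᵢ≡x p = p λ vᵢ≡[] → contradiction (trans (sym vᵢ≡x) vᵢ≡[]) λ ()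

  letter-irreducible : ∀ {n x} (i : Fin n) v → lookup v i ≡ [ x ] → M ⊨ irreducible i [ v ]
  letter-irreducible i v vᵢ≡x u w uw≡vᵢ ¬¬u≢[] w≢[] =
    uw≡vᵢ λ eq → ¬¬u≢[] λ u≢[] → w≢[] (right-unit u w (trans eq vᵢ≡x) u≢[])
    where
    right-unit : ∀ {x : X} u w → u List.++ w ≡ [ x ] → u ≢ [] → w ≡ []
    right-unit []      w _  u≢[] = contradiction refl u≢[]
    right-unit (_ ∷ u) w eq _    = ++-conicalʳ u w (∷-injectiveʳ eq)

  -- A word with at least two letters splits into its first letter and a nonempty rest, neither of
  -- which is the unit.
  irreducible-letter : ∀ {n} (i : Fin n) v → M ⊨ nonUnit i [ v ] → M ⊨ irreducible i [ v ] →
                       ∃[ x ] lookup v i ≡ [ x ]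
  irreducible-letter i v nonunit irr with lookup v i
  ... | []         = ⊥-elim (nonunit λ k → k refl)
  ... | x ∷ []     = x , refl
  ... | x ∷ y ∷ zs = ⊥-elim (irr [ x ] (y ∷ zs) (λ k → k refl) (λ p → p λ ()) λ ())

  letterAutomorphism : X ↔ X → Automorphism M
  letterAutomorphism π = record
    { bijection = mk↔ₛ′ (List.map π.to) (List.map π.from)
        (inverse π.strictlyInverseˡ) (inverse π.strictlyInverseʳ)
    ; fun-homo  = λ { unit [] → refl ; mult (u ∷ v ∷ []) → map-++ π.to u v }
    ; rel-homo  = λ ()
    }
    where
    module π = Inverse π
    inverse : {f g : X → X} → (∀ x → f (g x) ≡ x) → ∀ w → List.map f (List.map g w) ≡ w
    inverse fg w = trans (sym (map-∘ w)) (trans (map-cong fg w) (map-id w))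

-- The formula defining an orbit.

module _ {X : Set} {k : ℕ} (X↔Fin : X ↔ Fin k) where
  private
    M : Structure monoidLanguage
    M = freeMonoid X

    module X↔Fin = Inverse X↔Fin

    _≟X_ : DecidableEquality X
    _≟X_ = inj⇒≟ (Inverse⇒Injection X↔Fin)

    anyX? : {Q : Pred X 0ℓ} → Decidable Q → Dec (∃ Q)
    anyX? {Q} Q? = map′ (λ (i , q) → X↔Fin.from i , q)
      (λ (x , q) → X↔Fin.to x , subst Q (sym (X↔Fin.strictlyInverseʳ x)) q)
      (any? (Q? ∘ X↔Fin.from))

  -- A disjunction in negative form: no irreducible non-unit differs from all `k` enumerated words.
  -- Distinctness of these words then follows by counting.
  exhaustive : ∀ n → Formula monoidLanguage (k + n)
  exhaustive n = all (nonUnit zero ⇒ irreducible zero ⇒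
    (λ (i : Fin k) → ~ (var zero ≐ var (suc (i ↑ˡ n)))) ⇛ bot)

  equation : ∀ {n} → Vec (List X) n → Fin n → Formula monoidLanguage (k + n)
  equation {n} a j =
    var (k ↑ʳ j) ≐ wordTerm (λ x → var (X↔Fin.to x ↑ˡ n)) (lookup a j)

  -- The first k variables enumerate the letters; the other n are the free ones.
  orbitFormula : ∀ {n} → Vec (List X) n → Formula monoidLanguage n
  orbitFormula {n} a = ~ alls k
    ((λ (i : Fin k) → nonUnit (i ↑ˡ n)) ⇛ (λ (i : Fin k) → irreducible (i ↑ˡ n)) ⇛
     exhaustive n ⇒ equation a ⇛ bot)

  -- The existential witness is the list of one-letter words in the order given by `X↔Fin`.
  orbitFormula-refl : ∀ {n} (a : Vec (List X) n) → M ⊨ orbitFormula a [ a ]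
  orbitFormula-refl {n} a h =
    to (⊨-⇛ M (equation a))
      (to (⊨-⇛ M (λ i → irreducible (i ↑ˡ n)))
        (to (⊨-⇛ M (λ i → nonUnit (i ↑ˡ n))) (to (⊨-alls M k) h letters)
          λ i → letter-nonUnit (i ↑ˡ n) (letters ++ a) (letter i))
        (λ i → letter-irreducible (i ↑ˡ n) (letters ++ a) (letter i))
        letters-exhaustive)
      equations
    where
    letters : Vec (List X) k
    letters = tabulate ([_] ∘ X↔Fin.from)

    letter : ∀ i → lookup (letters ++ a) (i ↑ˡ n) ≡ [ X↔Fin.from i ]
    letter i = trans (lookup-++ˡ letters a i) (lookup∘tabulate _ i)

    letter-to : ∀ x → lookup (letters ++ a) (X↔Fin.to x ↑ˡ n) ≡ [ x ]
    letter-to x = trans (letter (X↔Fin.to x)) (cong [_] (X↔Fin.strictlyInverseʳ x))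

    letters-exhaustive : M ⊨ exhaustive n [ letters ++ a ]
    letters-exhaustive z z-nonUnit z-irreducible =
      from (⊨-⇛ M (λ i → ~ (var zero ≐ var (suc (i ↑ˡ n))))) λ z∉ →
        let x , z≡x = irreducible-letter zero (z ∷ letters ++ a) z-nonUnit z-irreducible
        -- The letter `x` stands in the enumeration at position `X↔Fin.to x`.
        in z∉ (X↔Fin.to x) λ p → p (trans z≡x (sym (letter-to x)))

    equations : ∀ j → M ⊨ equation a j [ letters ++ a ]
    equations j p = p (begin
      lookup (letters ++ a) (k ↑ʳ j)   ≡⟨ lookup-++ʳ letters a j ⟩
      lookup a j                       ≡⟨ map-id (lookup a j) ⟨
      List.map id (lookup a j)         ≡⟨ eval-wordTerm letter-to (lookup a j) ⟨
      eval M (wordTerm _ (lookup a j)) (letters ++ a) ∎)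
      where open ≡-Reasoning

  -- The combinatorial content of the orbit formula. Surjectivity is indexed by `Fin k`, so that
  -- finite search decides it.
  record Relabels {n} (a b : Vec (List X) n) (s : Fin k → X) : Set where
    constructor _,_
    field
      surjective : ∀ i → ∃[ j ] s j ≡ X↔Fin.from i
      maps       : map (List.map (s ∘ X↔Fin.to)) a ≡ b

  relabels? : ∀ {n} (a b : Vec (List X) n) → Decidable (Relabels a b)
  relabels? a b s = map′ (λ (p , q) → p , q) (λ (p , q) → p , q)
    (all? (λ i → any? λ j → s j ≟X X↔Fin.from i) ×-dec vec-≡-dec (list-≡-dec _≟X_) _ b)

  -- A surjection between sets of `k` elements is bijective, so `s ∘ X↔Fin.to` is a permutation of
  -- the letters.
  relabels⇒automorphism : ∀ {n} {a b : Vec (List X) n} {s} → Relabels a b s →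
                          Σ[ α ∈ Automorphism M ] map (Automorphism.to α) a ≡ b
  relabels⇒automorphism {s = s} (surj , maps) =
    letterAutomorphism (↔-trans X↔Fin (surjective⇒↔ X↔Fin s λ x →
      let j , eq = surj (X↔Fin.to x) in j , trans eq (X↔Fin.strictlyInverseʳ x)))
    , maps

  -- The existential quantifier is a negated universal one and yields a witness only up to double
  -- negation. Since there are finitely many candidate vectors of letters and `Relabels` is
  -- decidable, the witness can be extracted.
  orbitFormula⇒relabels : ∀ {n} (a b : Vec (List X) n) → M ⊨ orbitFormula a [ b ] →
                          ∃ (Relabels a b ∘ lookup)
  orbitFormula⇒relabels {n} a b φb =
    decidable-stable (any-vec? anyX? k (relabels? a b ∘ lookup)) λ none →
      φb (from (⊨-alls M k) λ y →
        from (⊨-⇛ M (λ i → nonUnit (i ↑ˡ n))) λ y-nonUnit →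
        from (⊨-⇛ M (λ i → irreducible (i ↑ˡ n))) λ y-irreducible y-exhaustive →
        from (⊨-⇛ M (equation a)) λ y-solves →
          none (relabels y
            (λ i → irreducible-letter (i ↑ˡ n) (y ++ b) (y-nonUnit i) (y-irreducible i))
            y-exhaustive y-solves))
    where
    relabels : ∀ y → (∀ i → ∃[ x ] lookup (y ++ b) (i ↑ˡ n) ≡ [ x ]) →
               M ⊨ exhaustive n [ y ++ b ] → (∀ j → M ⊨ equation a j [ y ++ b ]) →
               ∃ (Relabels a b ∘ lookup)
    relabels y letter y-exhaustive y-solves = s , surj , lookup-ext maps
      where
      s : Vec X k
      s = tabulate (proj₁ ∘ letter)

      letter-s : ∀ i → lookup (y ++ b) (i ↑ˡ n) ≡ [ lookup s i ]
      letter-s i = trans (proj₂ (letter i)) (cong [_] (sym (lookup∘tabulate (proj₁ ∘ letter) i)))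

      surj : ∀ i → ∃[ j ] lookup s j ≡ X↔Fin.from i
      -- A letter missed by `s` would be an irreducible non-unit different from every entry of `y`.
      surj i = decidable-stable (any? λ j → lookup s j ≟X X↔Fin.from i) λ miss →
        to (⊨-⇛ M (λ j → ~ (var zero ≐ var (suc (j ↑ˡ n)))))
          (y-exhaustive z (letter-nonUnit zero (z ∷ y ++ b) refl)
                          (letter-irreducible zero (z ∷ y ++ b) refl))
          λ j p → p λ z≡yⱼ → miss (j , sym (∷-injectiveˡ (trans z≡yⱼ (letter-s j))))
        where
        z : List X
        z = [ X↔Fin.from i ]

      maps : ∀ j → lookup (map (List.map (lookup s ∘ X↔Fin.to)) a) j ≡ lookup b j
      -- Satisfaction gives the equation only doubly negated; decidable equality of words recovers
      -- it.
      maps j = decidable-stable (list-≡-dec _≟X_ _ _) λ ≢ → y-solves j λ eq → ≢ (begin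
        lookup (map (List.map (lookup s ∘ X↔Fin.to)) a) j  ≡⟨ lookup-map j _ a ⟩
        List.map (lookup s ∘ X↔Fin.to) (lookup a j)
          ≡⟨ eval-wordTerm (letter-s ∘ X↔Fin.to) (lookup a j) ⟨
        eval M (wordTerm _ (lookup a j)) (y ++ b)          ≡⟨ eq ⟨
        lookup (y ++ b) (k ↑ʳ j)                           ≡⟨ lookup-++ʳ y b j ⟩
        lookup b j                                         ∎)
        where open ≡-Reasoning

  orbitFormula⇒automorphism : ∀ {n} (a b : Vec (List X) n) → M ⊨ orbitFormula a [ b ] →
                              Σ[ α ∈ Automorphism M ] map (Automorphism.to α) a ≡ b
  orbitFormula⇒automorphism a b φb =
    relabels⇒automorphism (proj₂ (orbitFormula⇒relabels a b φb))

theorem6 : (X : Set) (k : ℕ) → X ↔ Fin k → 2 ≤ k →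
    Atomic (freeMonoid X) × Homogeneous (freeMonoid X)
theorem6 X k X↔Fin _ =
    orbits-definable⇒atomic M φ (orbitFormula-refl X↔Fin) (orbitFormula⇒automorphism X↔Fin)
  , orbits-definable⇒homogeneous M φ (orbitFormula-refl X↔Fin) (orbitFormula⇒automorphism X↔Fin)
  where
  M : Structure monoidLanguage
  M = freeMonoid X

  φ : ∀ {n} → Vec (List X) n → Formula monoidLanguage n
  φ = orbitFormula X↔Fin
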